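{- Let $(G,\beta)$ be an edge-labeled graph on vertices $v_1,\dots,v_n$, with module $m_i\mathbb{Z}$ at $v_i$ and module $\mathbb{Z}/r_{ij}\mathbb{Z}$ at each edge $v_iv_j$, and let $\mathcal{P}^1$ be the set of the longest paths of $v_1$. For each longest path $P_k\in\mathcal{P}^1$ (a path from some $v_j$ to $v_1$), let $F_k$ be a minimal spline, with nonzero entry $f_{kv_1}\neq0$ at $v_1$, on the edge-labeled path graph $(P_k,\beta|_{P_k})$. Then there exists a flow-up class $F^{(1)}=(f^{(1)}_{v_1},f^{(1)}_{v_2},\dots,f^{(1)}_{v_n})$ on $(G,\beta)$ whose first nonzero entry $f^{(1)}_{v_1}$ is equal to the least common multiple of all the $f_{kv_1}$.
   Context: Setting: $G$ is a finite graph with ordered vertex set $\{v_1,\dots,v_n\}$, whose edges are unordered pairs of distinct vertices. Each vertex $v_i$ carries the $\mathbb{Z}$-module $m_i\mathbb{Z}$ ($m_i\in\mathbb{Z}$) and each edge $v_iv_j$ the $\mathbb{Z}$-module $\beta(v_iv_j)=\mathbb{Z}/r_{ij}\mathbb{Z}$ ($r_{ij}=r_{ji}\in\mathbb{Z}$). A spline on $(G,\beta)$ is a tuple of integers $(f_{v_1},\dots,f_{v_n})$ with $f_{v_i}\in m_i\mathbb{Z}$ for all $i$ and $f_{v_i}\equiv f_{v_j}\pmod{r_{ij}}$ for every edge $v_iv_j$. An $i$-th flow-up class is a spline with $f_{v_i}\ne0$ and $f_{v_s}=0$ for $s<i$. Longest paths: a trail from $v_j$ to $v_i$ is an ordered sequence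 of vertices and edges from $v_j$ to $v_i$ with no repeated edge, regarded as a path graph (so its vertices are distinct). A longest path of $v_i$ is a trail ending at $v_i$ (starting from any vertex) that is maximal under strict inclusion among all trails ending at $v_i$, i.e. it is not strictly contained in another trail ending at $v_i$. (If $v_i$ is isolated, the only one is the trivial path consisting of $v_i$.) Minimal spline on a longest path $P$ of $v_i$: order the vertices of $P$ starting from its end $v_i$. $P$ is an edge-labeled graph with the vertex modules and edge labels inherited from $(G,\beta)$. A spline on $P$ with nonzero entry at $v_i$ is minimal if its entry at $v_i$ generates the ideal of $\mathbb{Z}$ consisting of all entries at $v_i$ of splines on $P$. -}

module Defs where

open import Data.Nat as ℕ using (ℕ; suc)
open import Data.Nat.Properties as ℕ using (1+n≢n)
open import Data.Fin using (Fin; zero; suc; toℕ; inject₁; _<_)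
open import Data.Fin.Properties using (toℕ-injective; toℕ-inject₁)
open import Data.Integer using (ℤ; 0ℤ; _-_; _≤_)
open import Data.Integer.Divisibility.Signed using (_∣_)
open import Data.Product using (_×_; ∃-syntax)
open import Data.Sum using (_⊎_; inj₁; inj₂; swap; [_,_]′)
open import Function using (_⇔_; _∘_)
open import Relation.Binary using (Decidable; Symmetric)
open import Relation.Nullary using (¬_)
open import Relation.Nullary.Decidable using (_⊎-dec_)
open import Relation.Binary.PropositionalEquality
  using (_≡_; _≢_; refl; sym; trans)

-- A finite simple graph on the ordered vertex set Fin n, with the module
-- (vertexLabel i) ℤ at the vertex i and ℤ / (edgeLabel i j) ℤ at the edge ij.
-- The value of edgeLabel at a pair of non-adjacent vertices is never used.
record EdgeLabeledGraph (n : ℕ) : Set₁ where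
  infix 4 _~_
  field
    _~_           : Fin n → Fin n → Set
    _~?_          : Decidable _~_
    ~-sym         : Symmetric _~_
    ~-irrefl      : ∀ i → ¬ (i ~ i)
    vertexLabel   : Fin n → ℤ
    edgeLabel     : Fin n → Fin n → ℤ
    edgeLabel-sym : ∀ {i j} → i ~ j → edgeLabel i j ≡ edgeLabel j i

open EdgeLabeledGraph

record IsSpline {n} (G : EdgeLabeledGraph n) (f : Fin n → ℤ) : Set where
  field
    inVertexModule : ∀ i → vertexLabel G i ∣ f i
    congruent      : ∀ {i j} → _~_ G i j → edgeLabel G i j ∣ f i - f j

record IsFlowUpClass {n} (G : EdgeLabeledGraph n) (i : Fin n) (f : Fin n → ℤ) : Set where
  field
    isSpline : IsSpline G f
    nonzero  : f i ≢ 0ℤ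
    vanishes : ∀ s → s < i → f s ≡ 0ℤ

-- A trail ending at v. Its vertices are listed starting from the end v, so that
-- the trail starts at vertex (fromℕ len) and ends at vertex zero. Since the
-- vertices are distinct, no edge is repeated. The trivial trail has len = 0.
record Trail {n} (G : EdgeLabeledGraph n) (v : Fin n) : Set where
  field
    len       : ℕ
    vertex    : Fin (suc len) → Fin n
    end       : vertex zero ≡ v
    adjacent  : ∀ s → _~_ G (vertex (inject₁ s)) (vertex (suc s))
    distinct  : ∀ {s t} → vertex s ≡ vertex t → s ≡ t

open Trail

Consecutive : ∀ {k} → Fin k → Fin k → Set
Consecutive s t = toℕ t ≡ suc (toℕ s) ⊎ toℕ s ≡ suc (toℕ t)

module _ {n} {G : EdgeLabeledGraph n} {v : Fin n} where

  private
    step : (P : Trail G v) (s t : Fin (suc (len P))) → toℕ t ≡ suc (toℕ s) →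
           _~_ G (vertex P s) (vertex P t)
    step P s (suc t) eq
      with refl ← toℕ-injective {i = inject₁ t} {j = s}
                    (trans (toℕ-inject₁ t) (ℕ.suc-injective eq))
      = adjacent P t

  consecutive⇒adjacent : (P : Trail G v) {s t : Fin (suc (len P))} →
                         Consecutive s t → _~_ G (vertex P s) (vertex P t)
  consecutive⇒adjacent P {s} {t} =
    [ step P s t , ~-sym G ∘ step P t s ]′

  -- The trail as an edge-labeled path graph; its vertices are ordered starting
  -- from v, and all labels are inherited from G.
  pathGraph : (P : Trail G v) → EdgeLabeledGraph (suc (len P))
  pathGraph P = record
    { _~_           = Consecutive
    ; _~?_          = λ s t → (toℕ t ℕ.≟ suc (toℕ s)) ⊎-dec (toℕ s ℕ.≟ suc (toℕ t))
    ; ~-sym         = swap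
    ; ~-irrefl      = λ s → [ 1+n≢n ∘ sym , 1+n≢n ∘ sym ]′
    ; vertexLabel   = λ s → vertexLabel G (vertex P s)
    ; edgeLabel     = λ s t → edgeLabel G (vertex P s) (vertex P t)
    ; edgeLabel-sym = λ c → edgeLabel-sym G (consecutive⇒adjacent P c)
    }

  infix 4 _⊆_ _⊂_

  -- Inclusion of the vertex sets and of the sets of (unordered) edges.
  record _⊆_ (P Q : Trail G v) : Set where
    field
      vertices : ∀ s → ∃[ t ] vertex Q t ≡ vertex P s
      edges    : ∀ {s s′} → Consecutive s s′ →
                 ∃[ t ] ∃[ t′ ] Consecutive t t′ ×
                   vertex Q t ≡ vertex P s × vertex Q t′ ≡ vertex P s′

  _⊂_ : Trail G v → Trail G v → Set
  P ⊂ Q = P ⊆ Q × ¬ (Q ⊆ P)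

record LongestPath {n} (G : EdgeLabeledGraph n) (v : Fin n) : Set where
  field
    trail   : Trail G v
    maximal : (Q : Trail G v) → ¬ (trail ⊂ Q)

  length : ℕ
  length = len trail

  graph : EdgeLabeledGraph (suc length)
  graph = pathGraph trail

-- On a path graph, vertex zero is the end of the path. The last field says that
-- the entry of f there generates the ideal of all such entries of splines.
record IsMinimalSpline {k} (P : EdgeLabeledGraph (suc k)) (f : Fin (suc k) → ℤ) : Set where
  field
    isSpline  : IsSpline P f
    nonzero   : f zero ≢ 0ℤ
    generates : ∀ x → f zero ∣ x ⇔ (∃[ g ] IsSpline P g × g zero ≡ x)

-- The (nonnegative) least common multiple of a family of integers.
record IsLCM {I : Set} (a : I → ℤ) (l : ℤ) : Set where
  field
    nonNegative    : 0ℤ ≤ l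
    commonMultiple : ∀ k → a k ∣ l
    least          : ∀ c → (∀ k → a k ∣ c) → l ∣ c

{-# OPTIONS --safe #-}
-- Since the ideals of ℤ form a distributive lattice, a vertex k can be removed
-- from a system of congruences f i ≡ f j (mod r i j), f i ≡ 0 (mod m i): by the
-- Chinese remainder theorem a solution at the other vertices extends to k as soon
-- as it also satisfies f i ≡ f j (mod gcd (r i k) (r j k)) and
-- f i ≡ 0 (mod gcd (r i k) (m k)). Removing all vertices but v₁ leaves a single
-- modulus L at v₁, and a spline f on G with f v₁ = L. Restricting f to a longest
-- path shows that every minimal entry divides L. Conversely L is a lattice
-- expression in the gcds of labels along walks from v₁ to a vertex w, together
-- with the modulus at w. Cutting out loops, such a gcd divides the one along a
-- simple path, which is contained in a longest path, so it divides the minimal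
-- entry there. Hence L lies in every set of naturals that contains the minimal
-- entries and is closed under divisors and lcm; the divisors of a common multiple
-- c give L ∣ c, and the nonzero naturals give L ≢ 0.
module Submission where

open import Defs
open import Data.Nat as ℕ using (ℕ; zero; suc; _≤_; _<_; z≤n; s≤s)
import Data.Nat.Properties as ℕ
import Data.Nat.Divisibility as ℕ
open import Data.Nat.GCD
open import Data.Nat.LCM
open import Data.Fin as Fin using (Fin; zero; suc; toℕ; fromℕ<; inject₁)
open import Data.Fin.Properties
  using (_≟_; any?; toℕ-injective; toℕ-fromℕ<; toℕ-inject₁; toℕ-inject≤; toℕ≤pred[n]; toℕ<n;
         injective⇒≤)
open import Data.Integer as ℤ using (ℤ; +_; _+_; _*_; _-_; -_; 0ℤ; ∣_∣)
import Data.Integer.Properties as ℤ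
open import Data.Integer.Divisibility.Signed
open import Data.Integer.Tactic.RingSolver using (solve-∀)
open import Data.Bool using (if_then_else_)
open import Data.Empty using (⊥-elim)
open import Data.List using (List; []; _∷_)
open import Data.Product using (_×_; _,_; ∃-syntax)
open import Data.Sum using (_⊎_; inj₁; inj₂)
import Data.Vec.Functional as Vector
open import Function using (_∘_; Equivalence)
open import Relation.Nullary using (¬_; Dec; yes; no; does; contradiction)
open import Relation.Nullary.Decidable using (dec-true; dec-false; _×-dec_)
open import Relation.Binary.PropositionalEquality
  using (_≡_; _≢_; refl; sym; trans; cong; cong₂; subst; subst₂)

open Trail

-- Distributivity of gcd over lcm, and ideals of the divisibility lattice.

gcd-mono-∣ : ∀ {a a′ b b′} → a ℕ.∣ a′ → b ℕ.∣ b′ → gcd a b ℕ.∣ gcd a′ b′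
gcd-mono-∣ {a} {b = b} p q =
  gcd-greatest (ℕ.∣-trans (gcd[m,n]∣m a b) p) (ℕ.∣-trans (gcd[m,n]∣n a b) q)

-- The converse divisibility holds in every lattice. Here gcd a b is cancelled
-- after multiplication by it, using gcd a b * lcm a b = a * b.
gcd-distribˡ-lcm : ∀ g a b → gcd g (lcm a b) ℕ.∣ lcm (gcd g a) (gcd g b)
gcd-distribˡ-lcm g a b with gcd a b ℕ.≟ 0
... | yes d≡0 rewrite gcd[m,n]≡0⇒m≡0 {a} {b} d≡0 | lcm[0,n]≡0 b = m∣lcm[m,n] _ _
... | no d≢0 = ℕ.*-cancelˡ-∣ d {{ℕ.≢-nonZero d≢0}} (subst (d ℕ.* G ℕ.∣_) (ℕ.*-comm c d)
    (subst (d ℕ.* G ℕ.∣_) (sym (c*gcd[m,n]≡gcd[cm,cn] c a b))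
      (gcd-greatest dG∣ca dG∣cb)))
  where
  d = gcd a b
  G = gcd g (lcm a b)
  c = lcm (gcd g a) (gcd g b)

  dG∣ab : d ℕ.* G ℕ.∣ a ℕ.* b
  dG∣ab = subst (d ℕ.* G ℕ.∣_) (gcd*lcm a b) (ℕ.*-monoʳ-∣ d (gcd[m,n]∣n g (lcm a b)))

  -- `d * G` divides `x * g` and `x * y`, hence `x * gcd g y`, hence `c * x`; the pair (x, y) is
  -- taken as (a, b) and as (b, a).
  through : ∀ {x y} → d ℕ.∣ x → d ℕ.* G ℕ.∣ x ℕ.* y → gcd g y ℕ.∣ c → d ℕ.* G ℕ.∣ c ℕ.* x
  through {x} {y} d∣x dG∣xy h = ℕ.∣-trans
    (subst (d ℕ.* G ℕ.∣_) (sym (c*gcd[m,n]≡gcd[cm,cn] x g y))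
      (gcd-greatest (ℕ.*-pres-∣ d∣x (gcd[m,n]∣m g (lcm a b))) dG∣xy))
    (subst (x ℕ.* gcd g y ℕ.∣_) (ℕ.*-comm x c) (ℕ.*-monoʳ-∣ x h))

  dG∣ca : d ℕ.* G ℕ.∣ c ℕ.* a
  dG∣ca = through (gcd[m,n]∣m a b) dG∣ab (n∣lcm[m,n] (gcd g a) (gcd g b))

  dG∣cb : d ℕ.* G ℕ.∣ c ℕ.* b
  dG∣cb = through (gcd[m,n]∣n a b) (subst (d ℕ.* G ℕ.∣_) (ℕ.*-comm a b) dG∣ab)
            (m∣lcm[m,n] (gcd g a) (gcd g b))

gcd-distribʳ-lcm : ∀ g a b → gcd (lcm a b) g ℕ.∣ lcm (gcd a g) (gcd b g)
gcd-distribʳ-lcm g a b rewrite gcd-comm (lcm a b) g | gcd-comm a g | gcd-comm b g =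
  gcd-distribˡ-lcm g a b

-- Working with an abstract ideal lets one induction give both `L ∣ c` and `L ≢ 0`.
record IsIdeal (C : ℕ → Set) : Set where
  field
    down : ∀ {a b} → a ℕ.∣ b → C b → C a
    join : ∀ {a b} → C a → C b → C (lcm a b)

  gcd-join : ∀ g {a b} → C (gcd g a) → C (gcd g b) → C (gcd g (lcm a b))
  gcd-join g {a} {b} p q = down (gcd-distribˡ-lcm g a b) (join p q)

open IsIdeal

divisorsIdeal : ∀ c → IsIdeal (ℕ._∣ c)
divisorsIdeal c = record { down = ℕ.∣-trans ; join = lcm-least }

nonzeroIdeal : IsIdeal (_≢ 0)
nonzeroIdeal = record
  { down = λ { {b = b} a∣b b≢0 refl → b≢0 (ℕ.0∣⇒≡0 a∣b) }
  ; join = λ {a} {b} a≢0 b≢0 l≡0 →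
      ℕ.≢-nonZero⁻¹ (a ℕ.* b) {{ℕ.m*n≢0 a b {{ℕ.≢-nonZero a≢0}} {{ℕ.≢-nonZero b≢0}}}}
        (trans (sym (gcd*lcm a b)) (trans (cong (gcd a b ℕ.*_) l≡0) (ℕ.*-zeroʳ (gcd a b))))
  }

-- Signed divisibility and the Chinese remainder theorem.

∣-minus-swap : ∀ {d} x y → d ∣ x - y → d ∣ y - x
∣-minus-swap {d} x y p = subst (d ∣_) (identity x y) (∣m⇒∣-m p)
  where
  identity : ∀ x y → - (x - y) ≡ y - x
  identity = solve-∀

∣-minus-refl : ∀ {d} x → d ∣ x - x
∣-minus-refl {d} x = divides 0ℤ (ℤ.+-inverseʳ x)

∣-minus-trans : ∀ {d} x y z → d ∣ x - y → d ∣ y - z → d ∣ x - z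
∣-minus-trans {d} x y z p q = subst (d ∣_) (identity x y z) (∣m∣n⇒∣m+n p q)
  where
  identity : ∀ x y z → (x - y) + (y - z) ≡ x - z
  identity = solve-∀

∣ℕ-trans : ∀ {a b z} → a ℕ.∣ b → + b ∣ z → + a ∣ z
∣ℕ-trans a∣b = ∣-trans (∣ᵤ⇒∣ a∣b)

bézout : ∀ m n → ∃[ s ] ∃[ t ] (+ gcd m n ≡ s * + m + t * + n)
bézout m n with Bézout.identity (gcd-GCD m n)
... | Bézout.+- x y eq = + x , - (+ y) , solved (+ gcd m n) (+ x) (+ y) (+ m) (+ n)
    (trans (cong (_+_ (+ gcd m n)) (sym (ℤ.pos-* y n))) (trans (cong +_ eq) (ℤ.pos-* x m)))
  where
  identity : ∀ d y n → d ≡ (d + y * n) + - y * n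
  identity = solve-∀
  solved : ∀ d x y m n → d + y * n ≡ x * m → d ≡ x * m + - y * n
  solved d x y m n eq = trans (identity d y n) (cong (_+ - y * n) eq)
... | Bézout.-+ x y eq = - (+ x) , + y , solved (+ gcd m n) (+ x) (+ y) (+ m) (+ n)
    (trans (cong (_+_ (+ gcd m n)) (sym (ℤ.pos-* x m))) (trans (cong +_ eq) (ℤ.pos-* y n)))
  where
  identity : ∀ d x m → d ≡ - x * m + (d + x * m)
  identity = solve-∀
  solved : ∀ d x y m n → d + x * m ≡ y * n → d ≡ - x * m + y * n
  solved d x y m n eq = trans (identity d x m) (cong (_+_ (- x * m)) eq)

crt₂ : ∀ {m n} a b → + gcd m n ∣ a - b → ∃[ y ] (+ m ∣ a - y) × (+ n ∣ b - y)
crt₂ {m} {n} a b (divides q eq) with bézout m n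
-- As `a - b = q * (s * m + t * n)`, the number `a - q * s * m` equals `b + q * t * n`.
... | s , t , d≡ = a - q * s * + m
    , divides (q * s) (atFirst a (q * s * + m))
    , divides (- (q * t)) (trans (atSecond a b (q * s * + m))
        (trans (cong (λ z → - z + q * s * + m) (trans eq (cong (q *_) d≡)))
               (cancel q s t (+ m) (+ n))))
  where
  atFirst : ∀ a u → a - (a - u) ≡ u
  atFirst = solve-∀
  atSecond : ∀ a b u → b - (a - u) ≡ - (a - b) + u
  atSecond = solve-∀
  cancel : ∀ q s t m n → - (q * (s * m + t * n)) + q * s * m ≡ - (q * t) * n
  cancel = solve-∀

lcmAll : ∀ {n} → (Fin n → ℕ) → ℕ
lcmAll = Vector.foldr lcm 1

∣lcmAll : ∀ {n} (d : Fin n → ℕ) i → d i ℕ.∣ lcmAll d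
∣lcmAll d zero    = m∣lcm[m,n] (d zero) _
∣lcmAll d (suc i) = ℕ.∣-trans (∣lcmAll (d ∘ suc) i) (n∣lcm[m,n] (d zero) _)

gcd-lcmAll-least : ∀ {n} g (d : Fin n → ℕ) {c} →
                   (∀ i → gcd g (d i) ℕ.∣ c) → gcd g (lcmAll d) ℕ.∣ c
gcd-lcmAll-least {zero}  g d h = subst (ℕ._∣ _) (sym (gcd-zeroʳ g)) (ℕ.1∣ _)
gcd-lcmAll-least {suc n} g d h =
  gcd-join (divisorsIdeal _) g (h zero) (gcd-lcmAll-least g (d ∘ suc) (h ∘ suc))

-- Induction merges the head congruence with a solution `y₀` of the tail, taken modulo the lcm of
-- the tail moduli. By distributivity, the gcd of the head modulus with that lcm is the lcm of the
-- pairwise gcds, so pairwise compatibility is enough.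
crt : ∀ {n} (d : Fin n → ℕ) (a : Fin n → ℤ) →
      (∀ i j → i Fin.< j → + gcd (d i) (d j) ∣ a i - a j) →
      ∃[ y ] (∀ i → + d i ∣ a i - y)
crt {zero}  d a compatible = 0ℤ , λ ()
crt {suc n} d a compatible =
  let y₀ , solves₀ = crt (d ∘ suc) (a ∘ suc) (λ i j i<j → compatible (suc i) (suc j) (ℕ.s≤s i<j))
      agree i = ∣-minus-trans (a zero) (a (suc i)) y₀
        (compatible zero (suc i) (ℕ.s≤s ℕ.z≤n))
        (∣ℕ-trans (gcd[m,n]∣n (d zero) (d (suc i))) (solves₀ i))
      y , p , q = crt₂ {d zero} {lcmAll (d ∘ suc)} (a zero) y₀
        (∣ᵤ⇒∣ (gcd-lcmAll-least (d zero) (d ∘ suc) (λ i → ∣⇒∣ᵤ (agree i))))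
  in y , λ
  { zero    → p
  ; (suc i) → ∣-minus-trans (a (suc i)) y₀ y (solves₀ i) (∣ℕ-trans (∣lcmAll (d ∘ suc) i) q)
  }

-- Systems of congruences and elimination of vertices.

record System (n : ℕ) : Set where
  field
    label     : Fin n → Fin n → ℕ
    label-sym : ∀ i j → label i j ≡ label j i
    modulus   : Fin n → ℕ

open System

record IsSolution {n} (S : System n) (f : Fin n → ℤ) : Set where
  field
    modular   : ∀ i → + modulus S i ∣ f i
    congruent : ∀ i j → + label S i j ∣ f i - f j

open IsSolution

-- Vertex 1 is removed rather than vertex 0, so that `zero` is v₁ at every stage and its entry
-- survives definitionally.
pivot : ∀ {n} → Fin (suc (suc n))
pivot = suc zero

remaining : ∀ {n} → Fin (suc n) → Fin (suc (suc n))
remaining = Fin.punchIn pivot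

eliminate : ∀ {n} → System (suc (suc n)) → System (suc n)
eliminate S = record
  { label     = λ i j → lcm (label S (remaining i) (remaining j))
                            (gcd (label S (remaining i) pivot) (label S (remaining j) pivot))
  ; label-sym = λ i j → cong₂ lcm (label-sym S (remaining i) (remaining j))
                                  (gcd-comm (label S (remaining i) pivot) _)
  ; modulus   = λ i → lcm (modulus S (remaining i))
                          (gcd (label S (remaining i) pivot) (modulus S pivot))
  }

residual : ∀ {n} → System (suc n) → ℕ
residual {zero}  S = modulus S zero
residual {suc n} S = residual (eliminate S)

module Extend {n} (S : System (suc (suc n))) {f : Fin (suc n) → ℤ}
              (solution : IsSolution (eliminate S) f) where

  toPivot : Fin (suc n) → ℕ
  toPivot i = label S (remaining i) pivot

  -- Membership of the new value in its vertex module is one more congruence, with residue 0, so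
  -- `crt` handles all conditions at the pivot at once.
  moduli : Fin (suc (suc n)) → ℕ
  moduli = modulus S pivot Vector.∷ toPivot

  residues : Fin (suc (suc n)) → ℤ
  residues = 0ℤ Vector.∷ f

  compatible : ∀ i j → i Fin.< j → + gcd (moduli i) (moduli j) ∣ residues i - residues j
  compatible zero (suc j) _ = ∣-minus-swap (f j) 0ℤ
    (subst (+ gcd (modulus S pivot) (toPivot j) ∣_) (sym (ℤ.+-identityʳ (f j)))
      (subst (λ d → + d ∣ f j) (gcd-comm (toPivot j) (modulus S pivot))
        (∣ℕ-trans (n∣lcm[m,n] (modulus S (remaining j)) (gcd (toPivot j) (modulus S pivot)))
                  (modular solution j))))
  compatible (suc i) (suc j) _ =
    ∣ℕ-trans (n∣lcm[m,n] (label S (remaining i) (remaining j)) (gcd (toPivot i) (toPivot j)))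
             (congruent solution i j)

  old : ∀ i j → + label S (remaining i) (remaining j) ∣ f i - f j
  old i j =
    ∣ℕ-trans (m∣lcm[m,n] (label S (remaining i) (remaining j)) (gcd (toPivot i) (toPivot j)))
             (congruent solution i j)

  modular-old : ∀ i → + modulus S (remaining i) ∣ f i
  modular-old i =
    ∣ℕ-trans (m∣lcm[m,n] (modulus S (remaining i)) (gcd (toPivot i) (modulus S pivot)))
             (modular solution i)

  module _ (y : ℤ) (solves : ∀ i → + moduli i ∣ residues i - y) where

    extended : Fin (suc (suc n)) → ℤ
    extended = Vector.insertAt f pivot y

    new : ∀ i → + label S pivot (remaining i) ∣ y - f i
    new i = ∣-minus-swap (f i) y
      (subst (λ l → + l ∣ f i - y) (label-sym S (remaining i) pivot) (solves (suc i)))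

    extended-modular : ∀ i → + modulus S i ∣ extended i
    extended-modular zero          = modular-old zero
    extended-modular (suc zero)    =
      subst (+ modulus S pivot ∣_) (ℤ.+-identityʳ y) (∣-minus-swap 0ℤ y (solves zero))
    extended-modular (suc (suc i)) = modular-old (suc i)

    extended-congruent : ∀ i j → + label S i j ∣ extended i - extended j
    extended-congruent zero          zero          = old zero zero
    extended-congruent zero          (suc zero)    = solves (suc zero)
    extended-congruent zero          (suc (suc j)) = old zero (suc j)
    extended-congruent (suc zero)    zero          = new zero
    extended-congruent (suc zero)    (suc zero)    = ∣-minus-refl y
    extended-congruent (suc zero)    (suc (suc j)) = new (suc j)
    extended-congruent (suc (suc i)) zero          = old (suc i) zero
    extended-congruent (suc (suc i)) (suc zero)    = solves (suc (suc i))
    extended-congruent (suc (suc i)) (suc (suc j)) = old (suc i) (suc j)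

  extension : ∃[ g ] IsSolution S g × g zero ≡ f zero
  extension =
    let y , solves = crt moduli residues compatible
    in extended y solves
     , record { modular = extended-modular y solves ; congruent = extended-congruent y solves }
     , refl

residual-attained : ∀ {n} (S : System (suc n)) →
                    ∃[ f ] IsSolution S f × f zero ≡ + residual S
residual-attained {zero}  S = (λ _ → + modulus S zero) , record
  { modular   = λ { zero → ∣-refl }
  ; congruent = λ _ _ → ∣-minus-refl (+ modulus S zero)
  } , refl
residual-attained {suc n} S =
  let f , solution , f₀≡ = residual-attained (eliminate S)
      g , solution′ , g₀≡ = Extend.extension S solution
  in g , solution′ , trans g₀≡ f₀≡

-- In the application, A i g says that, for every walk from i to some w, the gcd of
-- g, the labels along the walk and the modulus at w lies in C.
residual-minimal : ∀ {n} (S : System (suc n)) {C} → IsIdeal C →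
  {A : Fin (suc n) → ℕ → Set} → (∀ i → IsIdeal (A i)) →
  (∀ {i g} → A i g → C (gcd g (modulus S i))) →
  (∀ {i j g} → A i g → A j (gcd g (label S i j))) →
  A zero 0 → C (residual S)
residual-minimal {zero}  S {C} ideal ideals exit step start =
  subst C (gcd-identityˡ (modulus S zero)) (exit start)
residual-minimal {suc n} S {C} ideal {A} ideals exit step start =
  residual-minimal (eliminate S) ideal {A ∘ remaining} (ideals ∘ remaining)
    -- Each condition of the reduced system is the lcm of an old one and of a detour through the
    -- pivot. The detour takes one more `step`, and `gcd-join` combines the two.
    (λ {i} {g} p → gcd-join ideal g (exit p)
      (subst C (gcd-assoc g (label S (remaining i) pivot) (modulus S pivot)) (exit (step p))))
    (λ {i} {j} {g} p → gcd-join (ideals (remaining j)) g (step p)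
      (subst (A (remaining j))
        (trans (gcd-assoc g (label S (remaining i) pivot) (label S pivot (remaining j)))
               (cong (λ l → gcd g (gcd (label S (remaining i) pivot) l))
                     (label-sym S pivot (remaining j))))
        (step (step p))))
    start

-- Gcds along walks.

module _ {n} (S : System n) where

  -- The accumulator `g` collects the labels already passed and starts at 0, the neutral element of
  -- gcd. Any list of vertices counts as a walk.
  walkGcd : ℕ → Fin n → List (Fin n) → ℕ
  walkGcd g i []       = gcd g (modulus S i)
  walkGcd g i (j ∷ js) = walkGcd (gcd g (label S i j)) j js

  walkGcd-mono-∣ : ∀ {g h} i js → g ℕ.∣ h → walkGcd g i js ℕ.∣ walkGcd h i js
  walkGcd-mono-∣ i []       p = gcd-mono-∣ p ℕ.∣-refl
  walkGcd-mono-∣ i (j ∷ js) p = walkGcd-mono-∣ j js (gcd-mono-∣ p ℕ.∣-refl)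

  walkGcd-∣ : ∀ g i js → walkGcd g i js ℕ.∣ g
  walkGcd-∣ g i []       = gcd[m,n]∣m g (modulus S i)
  walkGcd-∣ g i (j ∷ js) =
    ℕ.∣-trans (walkGcd-∣ (gcd g (label S i j)) j js) (gcd[m,n]∣m g (label S i j))

  -- Distributivity is applied one label at a time. This closes the predicate on accumulators in
  -- `walkGcd-residual` under lcm.
  walkGcd-lcm : ∀ g h i js → walkGcd (lcm g h) i js ℕ.∣ lcm (walkGcd g i js) (walkGcd h i js)
  walkGcd-lcm g h i []       = gcd-distribʳ-lcm (modulus S i) g h
  walkGcd-lcm g h i (j ∷ js) = ℕ.∣-trans
    (walkGcd-mono-∣ j js (gcd-distribʳ-lcm (label S i j) g h))
    (walkGcd-lcm _ _ j js)

walkGcd-residual : ∀ {n} (S : System (suc n)) {C} → IsIdeal C →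
                   (∀ js → C (walkGcd S 0 zero js)) → C (residual S)
walkGcd-residual S {C} ideal = residual-minimal S ideal
  {λ i g → ∀ js → C (walkGcd S g i js)}
  (λ i → record
    { down = λ a∣b p js → down ideal (walkGcd-mono-∣ S i js a∣b) (p js)
    ; join = λ p q js → down ideal (walkGcd-lcm S _ _ i js) (join ideal (p js) (q js))
    })
  (λ p → p [])
  (λ {i} {j} p js → p (j ∷ js))

-- From edge-labeled graphs to systems of congruences.

module _ {n} (G : EdgeLabeledGraph n) where
  open EdgeLabeledGraph G

  -- Non-adjacent vertices get the label 1, which imposes no condition.
  graphLabel : Fin n → Fin n → ℕ
  graphLabel i j = if does (i ~? j) then ∣ edgeLabel i j ∣ else 1

  graphLabel-adjacent : ∀ {i j} → i ~ j → graphLabel i j ≡ ∣ edgeLabel i j ∣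
  graphLabel-adjacent {i} {j} i~j rewrite dec-true (i ~? j) i~j = refl

  graphLabel-nonadjacent : ∀ {i j} → ¬ (i ~ j) → graphLabel i j ≡ 1
  graphLabel-nonadjacent {i} {j} i≁j rewrite dec-false (i ~? j) i≁j = refl

  graphLabel-sym : ∀ i j → graphLabel i j ≡ graphLabel j i
  graphLabel-sym i j with i ~? j
  ... | yes i~j = trans (cong ∣_∣ (edgeLabel-sym i~j)) (sym (graphLabel-adjacent (~-sym i~j)))
  ... | no  i≁j = sym (graphLabel-nonadjacent (i≁j ∘ ~-sym))

  system : System n
  system = record
    { label     = graphLabel
    ; label-sym = graphLabel-sym
    ; modulus   = λ i → ∣ vertexLabel i ∣
    }

  solution⇒spline : ∀ {f} → IsSolution system f → IsSpline G f
  solution⇒spline {f} solution = record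
    { inVertexModule = λ i → ∣-trans m∣∣m∣ (modular solution i)
    ; congruent      = λ {i} {j} i~j → ∣-trans m∣∣m∣
        (subst (λ l → + l ∣ f i - f j) (graphLabel-adjacent i~j) (congruent solution i j))
    }

  restrict : ∀ {v f} → IsSpline G f → (P : Trail G v) → IsSpline (pathGraph P) (f ∘ vertex P)
  restrict spline P = record
    { inVertexModule = IsSpline.inVertexModule spline ∘ vertex P
    ; congruent      = IsSpline.congruent spline ∘ consecutive⇒adjacent P
    }

-- Simple paths, their extensions, and longest paths.

module _ {n} (G : EdgeLabeledGraph n) (v : Fin n) where
  open EdgeLabeledGraph G

  -- A trail of length k as the values at 0, …, k of a function on ℕ (with
  -- arbitrary values beyond k), so that truncation does not change the function.
  record Path (k : ℕ) : Set where
    field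
      at        : ℕ → Fin n
      at-zero   : at 0 ≡ v
      step      : ∀ s → s < k → at s ~ at (suc s)
      injective : ∀ {s t} → s ≤ k → t ≤ k → at s ≡ at t → s ≡ t

  open Path

  trivial : Path 0
  trivial = record
    { at        = λ _ → v
    ; at-zero   = refl
    ; step      = λ _ ()
    ; injective = λ { z≤n z≤n _ → refl }
    }

  truncate : ∀ {k s} → s ≤ k → Path k → Path s
  truncate s≤k p = record
    { at        = at p
    ; at-zero   = at-zero p
    ; step      = λ t t<s → step p t (ℕ.<-≤-trans t<s s≤k)
    ; injective = λ s≤ t≤ → injective p (ℕ.≤-trans s≤ s≤k) (ℕ.≤-trans t≤ s≤k)
    }

  path⇒trail : ∀ {k} → Path k → Trail G v
  path⇒trail {k} p = record
    { len      = k
    ; vertex   = at p ∘ toℕ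
    ; end      = at-zero p
    ; adjacent = λ s → subst (λ t → at p t ~ at p (suc (toℕ s))) (sym (toℕ-inject₁ s))
                         (step p (toℕ s) (toℕ<n s))
    ; distinct = λ {s} {t} eq → toℕ-injective (injective p (toℕ≤pred[n] s) (toℕ≤pred[n] t) eq)
    }

  length<order : ∀ {k} → Path k → k < n
  length<order p = injective⇒≤ (distinct (path⇒trail p))

  New : ∀ {k} → Path k → Fin n → Set
  New {k} p j = ∀ s → s ≤ k → at p s ≢ j

  new? : ∀ {k} (p : Path k) j → (∃[ s ] s ≤ k × at p s ≡ j) ⊎ New p j
  new? {k} p j with any? (λ s → at p (toℕ {suc k} s) ≟ j)
  ... | yes (s , eq) = inj₁ (toℕ s , toℕ≤pred[n] s , eq)
  ... | no none      = inj₂ λ s s≤k eq →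
    none (fromℕ< (s≤s s≤k) , trans (cong (at p) (toℕ-fromℕ< (s≤s s≤k))) eq)

  Extensible : ∀ {k} → Path k → Set
  Extensible {k} p = ∃[ j ] (at p k ~ j) × New p j

  extensible? : ∀ {k} (p : Path k) → Dec (Extensible p)
  extensible? {k} p = any? λ j → (at p k ~? j) ×-dec dec-new j
    where
    dec-new : ∀ j → Dec (New p j)
    dec-new j with new? p j
    ... | inj₁ (s , s≤k , eq) = no λ new → new s s≤k eq
    ... | inj₂ new            = yes new

  module Extended {k} (p : Path k) {j} (k~j : at p k ~ j) (new : New p j) where

    at′ : ℕ → Fin n
    at′ s = if does (s ℕ.≤? k) then at p s else j

    at′-old : ∀ {s} → s ≤ k → at′ s ≡ at p s
    at′-old {s} s≤k rewrite dec-true (s ℕ.≤? k) s≤k = refl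

    at′-new : at′ (suc k) ≡ j
    at′-new rewrite dec-false (suc k ℕ.≤? k) ℕ.1+n≰n = refl

    step′ : ∀ s → s < suc k → at′ s ~ at′ (suc s)
    step′ s (s≤s s≤k) with ℕ.m≤n⇒m<n∨m≡n s≤k
    ... | inj₁ s<k  = subst₂ _~_ (sym (at′-old s≤k)) (sym (at′-old s<k)) (step p s s<k)
    ... | inj₂ refl = subst₂ _~_ (sym (at′-old s≤k)) (sym at′-new) k~j

    injective′ : ∀ {s t} → s ≤ suc k → t ≤ suc k → at′ s ≡ at′ t → s ≡ t
    injective′ {s} {t} s≤ t≤ eq with ℕ.m≤n⇒m<n∨m≡n s≤ | ℕ.m≤n⇒m<n∨m≡n t≤
    ... | inj₁ (s≤s s≤k) | inj₁ (s≤s t≤k) =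
      injective p s≤k t≤k (trans (sym (at′-old s≤k)) (trans eq (at′-old t≤k)))
    ... | inj₁ (s≤s s≤k) | inj₂ refl =
      contradiction (trans (sym (at′-old s≤k)) (trans eq at′-new)) (new s s≤k)
    ... | inj₂ refl | inj₁ (s≤s t≤k) =
      contradiction (trans (sym (at′-old t≤k)) (trans (sym eq) at′-new)) (new t t≤k)
    ... | inj₂ refl | inj₂ refl = refl

    path : Path (suc k)
    path = record
      { at        = at′
      ; at-zero   = trans (at′-old z≤n) (at-zero p)
      ; step      = step′
      ; injective = injective′
      }

  -- Both `p` and `Q` have `v` at position 0, so `Q` carries the vertices of `p` at the same
  -- positions. A further vertex of `Q` would extend `p`; hence `Q` is no longer than `p` and is
  -- contained in it.
  module Maximality {k} (p : Path k) (stuck : ¬ Extensible p)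
                    (Q : Trail G v) (P⊆Q : path⇒trail p ⊆ Q) where

    same-index : ∀ {s t u} (s≤k : s ≤ k) → vertex Q t ≡ at p s →
                 vertex Q u ≡ at p (toℕ (fromℕ< (s≤s s≤k))) → toℕ t ≡ s → toℕ u ≡ s
    same-index s≤k Qt Qu t≡s = trans (cong toℕ (distinct Q
      (trans Qu (trans (cong (at p) (toℕ-fromℕ< (s≤s s≤k))) (sym Qt))))) t≡s

    -- An edge of P inside Q cannot lead back towards v, since P does not revisit vertices.
    mutual
      prefix : ∀ s → s ≤ k → ∃[ t ] toℕ t ≡ s × vertex Q t ≡ at p s
      prefix zero    _   = zero , refl , trans (end Q) (sym (at-zero p))
      prefix (suc s) s<k
        with s≤k ← ℕ.<⇒≤ s<k
        with t , t≡s , Qt ← prefix s s≤k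
        with u , u′ , consecutive , Qu , Qu′ ←
               _⊆_.edges P⊆Q {fromℕ< (s≤s s≤k)} {fromℕ< (s≤s s<k)}
                 (inj₁ (trans (toℕ-fromℕ< (s≤s s<k)) (cong suc (sym (toℕ-fromℕ< (s≤s s≤k))))))
        with u≡s ← same-index s≤k Qt Qu t≡s
        with Qu′≡ ← trans Qu′ (cong (at p) (toℕ-fromℕ< (s≤s s<k)))
        with consecutive
      ... | inj₁ u′≡1+u = u′ , trans u′≡1+u (cong suc u≡s) , Qu′≡
      ... | inj₂ u≡1+u′ = ⊥-elim (no-return s s<k u′ (trans (sym u≡s) u≡1+u′) Qu′≡)

      no-return : ∀ s → s < k → ∀ u → s ≡ suc (toℕ u) → vertex Q u ≢ at p (suc s)
      no-return (suc r) r<k u s≡1+u Qu =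
        let r≤k = ℕ.<⇒≤ (ℕ.<⇒≤ r<k)
            t , t≡r , Qt = prefix r r≤k
            t≡u = toℕ-injective (trans t≡r (ℕ.suc-injective s≡1+u))
        -- Position `r` of `Q` carries both `at p r` and `at p (2 + r)`, which injectivity forbids.
        in ℕ.m≢1+n+m r {1}
             (injective p r≤k r<k (trans (sym Qt) (trans (cong (vertex Q) t≡u) Qu)))

    bounded : len Q ≤ k
    bounded = ℕ.≮⇒≥ λ k<len →
      let q = fromℕ< k<len
          t , t≡k , Qt = prefix k ℕ.≤-refl
          q≡t = toℕ-injective (trans (toℕ-inject₁ q) (trans (toℕ-fromℕ< k<len) (sym t≡k)))
      in stuck (vertex Q (suc q)
               , subst (_~ vertex Q (suc q)) (trans (cong (vertex Q) q≡t) Qt) (adjacent Q q)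
               , λ s s≤k eq → let t , t≡s , Qt = prefix s s≤k in
                   ℕ.<⇒≢ (s≤s s≤k) (trans (sym t≡s)
                     (trans (cong toℕ (distinct Q (trans Qt eq))) (cong suc (toℕ-fromℕ< k<len)))))

    position : Fin (suc (len Q)) → Fin (suc k)
    position t = Fin.inject≤ t (s≤s bounded)

    position-vertex : ∀ t → at p (toℕ (position t)) ≡ vertex Q t
    position-vertex t =
      let u , u≡t , Qu = prefix (toℕ t) (ℕ.≤-trans (toℕ≤pred[n] t) bounded)
      in trans (cong (at p) (toℕ-inject≤ t (s≤s bounded)))
               (trans (sym Qu) (cong (vertex Q) (toℕ-injective u≡t)))

    position-consecutive : ∀ {s t} → Consecutive s t → Consecutive (position s) (position t)
    position-consecutive {s} {t} = subst₂ (λ a b → b ≡ suc a ⊎ a ≡ suc b)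
      (sym (toℕ-inject≤ s (s≤s bounded))) (sym (toℕ-inject≤ t (s≤s bounded)))

    ⊇ : Q ⊆ path⇒trail p
    ⊇ = record
      { vertices = λ s → position s , position-vertex s
      ; edges    = λ {s} {t} c →
          position s , position t , position-consecutive c , position-vertex s , position-vertex t
      }

  longestPath : ∀ {k} (p : Path k) → ¬ Extensible p → LongestPath G v
  longestPath p stuck = record
    { trail   = path⇒trail p
    ; maximal = λ Q (P⊆Q , Q⊈P) → Q⊈P (Maximality.⊇ p stuck Q P⊆Q)
    }

  -- Gcds along simple paths and the entries of splines at `v`.

  pathGcd : (ℕ → Fin n) → ℕ → ℕ
  pathGcd a zero    = 0
  pathGcd a (suc k) = gcd (pathGcd a k) (graphLabel G (a k) (a (suc k)))

  pathGcd-cong : ∀ {a b} k → (∀ {s} → s ≤ k → a s ≡ b s) → pathGcd a k ≡ pathGcd b k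
  pathGcd-cong zero    eq = refl
  pathGcd-cong (suc k) eq = cong₂ gcd (pathGcd-cong k (eq ∘ ℕ.m≤n⇒m≤1+n))
    (cong₂ (graphLabel G) (eq (ℕ.n≤1+n k)) (eq ℕ.≤-refl))

  pathGcd-anti : ∀ a {s k} → s ≤ k → pathGcd a k ℕ.∣ pathGcd a s
  pathGcd-anti a {k = zero}  z≤n = ℕ.∣-refl
  pathGcd-anti a {k = suc k} s≤ with ℕ.m≤n⇒m<n∨m≡n s≤
  ... | inj₁ (s≤s s≤k) = ℕ.∣-trans
    (gcd[m,n]∣m (pathGcd a k) (graphLabel G (a k) (a (suc k)))) (pathGcd-anti a s≤k)
  ... | inj₂ refl      = ℕ.∣-refl

  endGcd : (ℕ → Fin n) → ℕ → ℕ
  endGcd a t = gcd (pathGcd a t) ∣ vertexLabel (a t) ∣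

  endGcd-cong : ∀ {a b} k → (∀ {s} → s ≤ k → a s ≡ b s) → endGcd a k ≡ endGcd b k
  endGcd-cong k eq = cong₂ gcd (pathGcd-cong k eq) (cong (∣_∣ ∘ vertexLabel) (eq ℕ.≤-refl))

  module _ {k} (p : Path k) {f} (spline : IsSpline (pathGraph (path⇒trail p)) f) where

    telescope : ∀ t (i : Fin (suc k)) → toℕ i ≡ t → + pathGcd (at p) t ∣ f zero - f i
    telescope zero    zero    _    = ∣-minus-refl (f zero)
    telescope (suc t) (suc i) refl = ∣-minus-trans (f zero) (f (inject₁ i)) (f (suc i))
      (∣ℕ-trans (gcd[m,n]∣m (pathGcd (at p) t) l) (telescope t (inject₁ i) (toℕ-inject₁ i)))
      (∣ℕ-trans (gcd[m,n]∣n (pathGcd (at p) t) l) (∣-trans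
        (subst (λ d → + d ∣ edge) (sym label≡) ∣m∣∣m)
        (IsSpline.congruent spline {inject₁ i} {suc i} (inj₁ (cong suc (sym (toℕ-inject₁ i)))))))
      where
      l = graphLabel G (at p t) (at p (suc t))
      edge = edgeLabel (at p (toℕ (inject₁ i))) (at p (suc t))
      label≡ : l ≡ ∣ edge ∣
      label≡ rewrite toℕ-inject₁ i = graphLabel-adjacent G (step p t (toℕ<n i))

    -- `f zero` is `(f zero - f i) + f i`, where the difference telescopes along the path and `f i`
    -- lies in its vertex module. Inner positions `t` matter because a simple path cut out of a walk
    -- is only an initial segment of a longest path.
    endGcd∣spline : ∀ {t} → t ≤ k → endGcd (at p) t ℕ.∣ ∣ f zero ∣
    endGcd∣spline {t} t≤k = ∣⇒∣ᵤ {+ endGcd (at p) t} (subst (+ endGcd (at p) t ∣_)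
      (identity (f zero) (f i))
      (∣m∣n⇒∣m+n
        (∣ℕ-trans (gcd[m,n]∣m (pathGcd (at p) t) m) (telescope t i i≡t))
        (∣ℕ-trans (gcd[m,n]∣n (pathGcd (at p) t) m)
          (subst (λ s → + ∣ vertexLabel (at p s) ∣ ∣ f i) i≡t
            (∣-trans ∣m∣∣m (IsSpline.inVertexModule spline i))))))
      where
      i = fromℕ< (s≤s t≤k)
      i≡t = toℕ-fromℕ< (s≤s t≤k)
      m = ∣ vertexLabel (at p t) ∣
      identity : ∀ x y → (x - y) + y ≡ x
      identity = solve-∀

  module _ (F : (P : LongestPath G v) → Fin (suc (LongestPath.length P)) → ℤ)
           (splines : ∀ P → IsSpline (LongestPath.graph P) (F P))
           {C} (ideal : IsIdeal C) (entries : ∀ P → C ∣ F P zero ∣) where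

    -- The path grows at its far end until it is stuck, hence longest; positions up to `t` keep
    -- their vertices. Since a path has length below `n`, the bound rules out `fuel` being zero.
    endGcd∈ideal : ∀ fuel {k} → n ≤ fuel ℕ.+ k → (p : Path k) → ∀ {t} → t ≤ k → C (endGcd (at p) t)
    endGcd∈ideal fuel {k} bound p {t} t≤k with extensible? p
    ... | no stuck = down ideal (endGcd∣spline p (splines P) t≤k) (entries P)
      where P = longestPath p stuck
    endGcd∈ideal zero bound p t≤k | yes _ = contradiction (length<order p) (ℕ.≤⇒≯ bound)
    endGcd∈ideal (suc fuel) {k} bound p {t} t≤k | yes (j , k~j , new) =
      subst C (endGcd-cong t λ s≤t → at′-old (ℕ.≤-trans s≤t t≤k))
        (endGcd∈ideal fuel (subst (n ≤_) (sym (ℕ.+-suc fuel k)) bound) path (ℕ.m≤n⇒m≤1+n t≤k))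
      where open Extended p k~j new

    -- The path `p` is the loop-free remainder of the walk so far. On a return to position `s`, the
    -- loop is cut by truncating there, which only replaces the accumulated gcd by a multiple; a new
    -- neighbour extends `p`.
    walk∈ideal : ∀ js {k} (p : Path k) → C (walkGcd (system G) (pathGcd (at p) k) (at p k) js)
    walk∈ideal []       {k} p = endGcd∈ideal n (ℕ.m≤m+n n k) p ℕ.≤-refl
    walk∈ideal (j ∷ js) {k} p with new? p j
    ... | inj₁ (s , s≤k , refl) = down ideal
      (walkGcd-mono-∣ (system G) j js
        (ℕ.∣-trans (gcd[m,n]∣m (pathGcd (at p) k) (graphLabel G (at p k) j))
                   (pathGcd-anti (at p) s≤k)))
      (walk∈ideal js (truncate s≤k p))
    ... | inj₂ new = visit (at p k ~? j)
      where
      visit : Dec (at p k ~ j) → C (walkGcd (system G) (pathGcd (at p) k) (at p k) (j ∷ js))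
      visit (yes k~j) = subst C
        (cong₂ (λ g i → walkGcd (system G) g i js)
          (cong₂ gcd (pathGcd-cong k at′-old)
                     (cong₂ (graphLabel G) (at′-old ℕ.≤-refl) at′-new))
          at′-new)
        (walk∈ideal js path)
        where open Extended p k~j new
      -- The label is 1, so the gcd divides every number, in particular `endGcd (at p) k`, which is
      -- known to lie in `C`.
      visit (no k≁j) = down ideal
        (ℕ.∣-trans (walkGcd-∣ (system G) (gcd (pathGcd (at p) k) l) j js)
          (ℕ.∣-trans (gcd[m,n]∣n (pathGcd (at p) k) l)
            (subst (ℕ._∣ endGcd (at p) k) (sym (graphLabel-nonadjacent G k≁j))
                   (ℕ.1∣ endGcd (at p) k))))
        (walk∈ideal [] p)
        where l = graphLabel G (at p k) j

theorem6p11 : ∀ {n : ℕ} (G : EdgeLabeledGraph (suc n))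
    (F : (P : LongestPath G zero) → Fin (suc (LongestPath.length P)) → ℤ) →
    (∀ P → IsMinimalSpline (LongestPath.graph P) (F P)) →
    ∃[ f ] IsFlowUpClass G zero f × IsLCM (λ P → F P zero) (f zero)
theorem6p11 G F minimal =
  let f , solution , f₀≡L = residual-attained (system G)
      spline = solution⇒spline G solution
      -- Every walk from v₁ starts at the trivial path, whose `pathGcd` is the initial accumulator
      -- 0.
      contains = λ {C} (ideal : IsIdeal C) entries → walkGcd-residual (system G) ideal
        λ js → walk∈ideal G zero F (IsMinimalSpline.isSpline ∘ minimal) ideal entries js (trivial G zero)
  in f
   , record
     { isSpline = spline
     ; nonzero  = λ f₀≡0 → contains nonzeroIdeal
         (λ P → IsMinimalSpline.nonzero (minimal P) ∘ ℤ.∣i∣≡0⇒i≡0)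
         (ℤ.+-injective (trans (sym f₀≡L) f₀≡0))
     ; vanishes = λ _ ()
     }
   , record
     { nonNegative    = subst (0ℤ ℤ.≤_) (sym f₀≡L) (ℤ.+≤+ z≤n)
     ; commonMultiple = λ P → let open LongestPath P in
         Equivalence.from (IsMinimalSpline.generates (minimal P) (f zero))
           (f ∘ vertex trail , restrict G spline trail , cong f (end trail))
     ; least          = λ c common → subst (_∣ c) (sym f₀≡L)
         (∣ᵤ⇒∣ (contains (divisorsIdeal ∣ c ∣) (∣⇒∣ᵤ ∘ common)))
     }
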